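{- Let $M$ be a binary matrix, let $b$ be a binary vector, and let $M'=\begin{bmatrix} M\\ b^{\intercal}\end{bmatrix}$. Let $Y:=\operatorname{supp}(b)$. Then $M'$ is graphic if and only if there exist a connected multigraph $G=(V,E)$ and a spanning tree $T\subseteq E$ with $M=M(G,T)$ such that $G$ has a $Y$-splittable vertex.
   Context: Graphs are finite multigraphs. Let $G$ be a connected multigraph with spanning tree $T \subseteq E(G)$. For $f \in E(G) \setminus T$, the fundamental path $P_f(T) \subseteq T$ is the unique path in $T$ between the end-vertices of $f$. The representation matrix $M(G,T)$ is the binary $|T| \times |E(G)\setminus T|$ matrix, rows indexed by $T$ and columns by $E(G)\setminus T$, whose entry at $(e,f)$ is $1$ if and only if $e \in P_f(T)$. A binary matrix is graphic if it equals $M(G,T)$ for some such pair $(G,T)$. The set $\operatorname{supp}(b)$ of columns with a $1$-entry in $b^{\intercal}$ is identified with the corresponding set of edges of $E(G)\setminus T$. Splittability. For a multigraph $G$, $Y\subseteq E(G)$ and $v\in V(G)$, let $G_Y^v$ be the graph obtained from $G$ by removing the edges in $Y$ and the vertex $v$ together with its incident edges. The auxiliary graph $H_Y^v$ has one vertex for each connected component of $G_Y^v$, and $\{h_1,h_2\}$ is an edge of $H_Y^v$ if and only if some edge $\{v_1,v_2\}\in Y$ has $v_1\in V(h_1)$, $v_2\in V(h_2)$ (with a loop at $h_1$ if $h_1=h_2$). The vertex $v$ is $Y$-splittable with respect to $G$ if $H_Y^v$ is bipartite (in particular has no loops). -}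

module Defs where

open import Data.Bool using (Bool; true)
open import Data.Bool.Properties using () renaming (≡-setoid to Bool-setoid)
open import Data.Fin using (Fin)
open import Data.Fin.Properties using () renaming (_≟_ to _≟ᶠ_)
open import Data.Fin.Subset using (Subset; _∈_; ∁)
open import Data.List using (List; []; _∷_; map)
open import Data.List.Membership.DecPropositional using () renaming (_∈?_ to member?)
open import Data.List.Relation.Unary.Unique.Propositional using (Unique)
open import Data.Nat using (ℕ)
open import Data.Product using (Σ; ∃-syntax; _×_; _,_; proj₁; proj₂)
open import Data.Sum using (_⊎_) renaming (swap to ⊎-swap)
open import Data.Vec.Functional using (Vector)
open import Function.Bundles using (_↔_; module Inverse; Func)
open import Level using (0ℓ)
open import Relation.Binary.Bundles using (Setoid)
open import Relation.Binary.Core using (Rel)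
open import Relation.Binary.Definitions using (Symmetric; _Respects₂_)
open import Relation.Binary.PropositionalEquality using (_≡_; _≢_)
open import Relation.Nullary using (¬_; does)
open import Relation.Unary using (Pred)

------------------------------------------------------------------------
-- Multigraphs (loops and parallel edges allowed)

-- Edges are undirected: the order of the two ends carries no meaning,
-- see Joins.
record Multigraph (V E : Set) : Set where
  field
    ends : E → V × V

open Multigraph public

-- Finite multigraphs on p vertices and q edges.
FinMultigraph : ℕ → ℕ → Set
FinMultigraph p q = Multigraph (Fin p) (Fin q)

module _ {V E : Set} (G : Multigraph V E) where

  Joins : E → V → V → Set
  Joins e u w = ends G e ≡ (u , w) ⊎ ends G e ≡ (w , u)

  data Walk : V → V → Set where
    stop : ∀ {u} → Walk u u
    step : ∀ {u w x} (e : E) → Joins e u w → Walk w x → Walk u x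

  edges : ∀ {u w} → Walk u w → List E
  edges stop         = []
  edges (step e _ p) = e ∷ edges p

  -- The vertices of a walk, in order, without the initial one.
  visited : ∀ {u w} → Walk u w → List V
  visited stop                 = []
  visited (step {w = w} _ _ p) = w ∷ visited p

  IsPath : ∀ {u w} → Walk u w → Set
  IsPath {u} p = Unique (u ∷ visited p)

  Path : V → V → Set
  Path u w = Σ (Walk u w) IsPath

  -- A loop is a cycle of length 1, two parallel edges form one of length
  -- 2; going back and forth along one edge is ruled out by the second
  -- condition.
  IsCycle : ∀ {u} → Walk u u → Set
  IsCycle c = edges c ≢ [] × Unique (edges c) × Unique (visited c)

  -- Connected graphs are nonempty.
  Connected : Set
  Connected = V × (∀ u w → Path u w)

  Acyclic : Set
  Acyclic = ∀ u (c : Walk u u) → ¬ IsCycle c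

  IsTree : Set
  IsTree = Connected × Acyclic

  _++ʷ_ : ∀ {u w x} → Walk u w → Walk w x → Walk u x
  stop       ++ʷ q = q
  step e j p ++ʷ q = step e j (p ++ʷ q)

  reverse : ∀ {u w} → Walk u w → Walk w u
  reverse stop         = stop
  reverse (step e j p) = reverse p ++ʷ step e (⊎-swap j) stop

  -- Connected components, as the quotient of V by reachability: each
  -- vertex represents the component containing it.
  Components : Setoid 0ℓ 0ℓ
  Components = record
    { Carrier       = V
    ; _≈_           = Walk
    ; isEquivalence = record { refl = stop ; sym = reverse ; trans = _++ʷ_ }
    }

------------------------------------------------------------------------
-- Spanning trees and representation matrices

-- The spanning subgraph (V , T).
spanned : ∀ {p q} → FinMultigraph p q → (T : Subset q) →
          Multigraph (Fin p) (∃[ e ] e ∈ T)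
spanned G T .ends (e , _) = ends G e

IsSpanningTree : ∀ {p q} → FinMultigraph p q → Subset q → Set
IsSpanningTree G T = IsTree (spanned G T)

module _ {p q} (G : FinMultigraph p q) (T : Subset q)
         (tree : IsSpanningTree G T) where

  -- A path in a tree is determined by its ends, so it does not matter
  -- which path the connectedness of T provides.
  fundamentalPath : (f : Fin q) →
    Path (spanned G T) (proj₁ (ends G f)) (proj₂ (ends G f))
  fundamentalPath f = proj₂ (proj₁ tree) _ _

  fundamentalEdges : Fin q → List (Fin q)
  fundamentalEdges f =
    map proj₁ (edges (spanned G T) (proj₁ (fundamentalPath f)))

  M[_,_] : (∃[ e ] e ∈ T) → (∃[ f ] f ∈ ∁ T) → Bool
  M[ (e , _) , (f , _) ] = does (member? _≟ᶠ_ e (fundamentalEdges f))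

BinaryMatrix : ℕ → ℕ → Set
BinaryMatrix m n = Vector (Vector Bool n) m

-- M = M(G,T) for a connected multigraph G with spanning tree T; the
-- bijections rows and columns make the indexing by T and E(G) ∖ T
-- explicit.
record Representation {m n} (M : BinaryMatrix m n) : Set where
  field
    {order size} : ℕ
    graph        : FinMultigraph order size
    connected    : Connected graph
    T            : Subset size
    spanningTree : IsSpanningTree graph T
    rows         : Fin m ↔ (∃[ e ] e ∈ T)
    columns      : Fin n ↔ (∃[ f ] f ∈ ∁ T)
    represents   : ∀ i j → M i j ≡
      M[_,_] graph T spanningTree (Inverse.to rows i) (Inverse.to columns j)

  supp : Vector Bool n → Pred (Fin size) 0ℓ
  supp b e = ∃[ j ] b j ≡ true × proj₁ (Inverse.to columns j) ≡ e

Graphic : ∀ {m n} → BinaryMatrix m n → Set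
Graphic M = Representation M

------------------------------------------------------------------------
-- Splittable vertices

-- A graph, possibly with loops, whose vertices are given up to an
-- equivalence.
record Graph : Set₁ where
  field
    Vertices : Setoid 0ℓ 0ℓ
  open Setoid Vertices public using (Carrier; _≈_)
  field
    Adj      : Rel Carrier 0ℓ
    Adj-sym  : Symmetric Adj
    Adj-resp : Adj Respects₂ _≈_

Bipartite : Graph → Set
Bipartite H = Σ (Func Vertices Bool-setoid) λ side →
    ∀ {h₁ h₂} → Adj h₁ h₂ → Func.to side h₁ ≢ Func.to side h₂
  where open Graph H

module _ {V E : Set} (G : Multigraph V E) (Y : Pred E 0ℓ) (v : V) where

  -- G_Y^v: the edges in Y, the vertex v and the edges at v are removed.
  deleted : Multigraph (∃[ u ] u ≢ v)
    (∃[ e ] ¬ Y e × proj₁ (ends G e) ≢ v × proj₂ (ends G e) ≢ v)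
  deleted .ends (e , _ , n₁ , n₂) = (_ , n₁) , (_ , n₂)

  -- H_Y^v
  auxiliary : Graph
  auxiliary = record
    { Vertices = Components deleted
    ; Adj      = λ h₁ h₂ → ∃[ e ] Y e × (∃[ v₁ ] ∃[ v₂ ]
                   Joins G e (proj₁ v₁) (proj₁ v₂) × v₁ ≈ h₁ × v₂ ≈ h₂)
    ; Adj-sym  = λ (e , y , v₁ , v₂ , j , p , q) →
                   e , y , v₂ , v₁ , ⊎-swap j , q , p
    ; Adj-resp = (λ h (e , y , v₁ , v₂ , j , p , q) →
                   e , y , v₁ , v₂ , j , p , trans q h)
               , (λ h (e , y , v₁ , v₂ , j , p , q) →
                   e , y , v₁ , v₂ , j , trans p h , q)
    }
    where open Setoid (Components deleted) using (_≈_; trans)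

  Splittable : Set
  Splittable = Bipartite auxiliary

{-# OPTIONS --safe #-}
-- In a tree every closed walk uses each edge an even number of times, so the
-- parity with which the path from a root uses e is the side χ e of the
-- fundamental cut of e, and the entry of M(G,T) at (e , f) says whether f
-- crosses this cut.  A representation is thus a tree with cuts χ such that χ e
-- separates the ends of e but of no other tree edge.
--
-- Contracting a tree edge e₀ gives a vertex whose sides are those of the cut
-- χ e₀, and the chords crossing that cut are the support of the row of e₀.
-- Conversely a splittable vertex is split into the ends of a new tree edge:
-- each of its edges is attached to the end for which it crosses the new cut
-- precisely if it lies in Y.
module Submission where

open import Defs
open import Data.Bool using (Bool; true; false; not; _xor_; if_then_else_)
open import Data.Bool.Properties
  using (xor-assoc; xor-comm; xor-same; xor-identityʳ; ¬-not; not-¬)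
open import Data.Empty using (⊥-elim)
open import Data.Fin using (Fin; zero; suc; splitAt; join; _↑ˡ_; _↑ʳ_; punchIn; punchOut; _≟_)
open import Data.Fin.Properties
  using (+↔⊎; splitAt-↑ˡ; splitAt-↑ʳ; splitAt-join; join-splitAt; ↑ˡ-injective;
         ↑ʳ-injective; punchInᵢ≢i; punchIn-injective; punchIn-punchOut)
open import Data.Fin.Subset using (Subset; _∈_; _∉_; ∁)
open import Data.Fin.Subset.Properties using (x∈∁p⇒x∉p; x∉p⇒x∈∁p; x∈p⇒x∉∁p)
open import Data.List using () renaming (_∷_ to _∷ˡ_; map to mapˡ)
open import Data.List.Membership.DecPropositional using () renaming (_∈?_ to member?)
open import Data.List.Membership.Propositional using () renaming (_∈_ to _∈ˡ_; _∉_ to _∉ˡ_)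
open import Data.List.Membership.Propositional.Properties using (∈-map⁺; ∈-map⁻)
open import Data.List.Relation.Binary.Subset.Propositional using (_⊆_)
open import Data.List.Relation.Binary.Subset.Propositional.Properties
  using (All-resp-⊇; ∷⁺ʳ)
open import Data.List.Relation.Unary.All using () renaming ([] to []ᵃ)
open import Data.List.Relation.Unary.All.Properties using (¬Any⇒All¬; All¬⇒¬Any)
open import Data.List.Relation.Unary.AllPairs using () renaming ([] to []ᵘ; _∷_ to _∷ᵘ_)
open import Data.List.Relation.Unary.Any using (here; there)
open import Data.List.Relation.Unary.Unique.Propositional using (Unique)
open import Data.Nat using (ℕ; zero; suc; _+_)
open import Data.Product using (Σ; ∃; _×_; _,_; proj₁; proj₂) renaming (map to ×-map)
open import Data.Sum using (_⊎_; inj₁; inj₂; [_,_]′) renaming (map to ⊎-map; swap to ⊎-swap)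
open import Data.Sum.Properties using (inj₁-injective)
open import Data.Vec using (tabulate)
open import Data.Vec.Functional using (Vector; []; _∷_; _++_)
open import Data.Vec.Properties using ([]=⇒lookup; lookup⇒[]=; lookup∘tabulate)
open import Data.Vec.Properties.WithK using ([]=-irrelevant)
open import Function using (_∘_; id; const; case_of_)
open import Function.Bundles using (_↔_; _⇔_; mk⇔; mk↔ₛ′; Inverse; Injection; Func)
open import Function.Properties.Inverse using (↔-sym; ↔⇒↣)
open import Level using (0ℓ)
open import Relation.Binary.Definitions using (DecidableEquality)
open import Relation.Binary.PropositionalEquality
open import Relation.Nullary using (¬_; yes; no; does; contradiction; map′)
open import Relation.Nullary.Decidable using (does-⇔; dec-true; dec-false)
open import Relation.Unary using (Pred)

open Inverse using (to; from; strictlyInverseˡ; strictlyInverseʳ)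

-- Arithmetic modulo 2

xor-≡ : ∀ {a b} → a xor b ≡ false → a ≡ b
xor-≡ {true}  {true}  _ = refl
xor-≡ {false} {false} _ = refl

xor-≢ : ∀ {a b} → a xor b ≡ true → a ≢ b
xor-≢ {true}  {false} _ ()
xor-≢ {false} {true}  _ ()

≢-xor : ∀ {a b} → a ≢ b → a xor b ≡ true
≢-xor {true}  {true}  a≢b = contradiction refl a≢b
≢-xor {true}  {false} _   = refl
≢-xor {false} {true}  _   = refl
≢-xor {false} {false} a≢b = contradiction refl a≢b

xor-cancelˡ : ∀ a b → a xor (a xor b) ≡ b
xor-cancelˡ a b = trans (sym (xor-assoc a a b)) (cong (_xor b) (xor-same a))

xor-telescope : ∀ a b c → (a xor b) xor (b xor c) ≡ a xor c
xor-telescope a b c =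
  trans (xor-assoc a b (b xor c)) (cong (a xor_) (xor-cancelˡ b c))

-- Parities along walks

infix 6 _across_

-- The coboundary of `χ` modulo 2, evaluated at a pair of ends.
_across_ : {V : Set} → (V → Bool) → V × V → Bool
χ across (u , w) = χ u xor χ w

module _ {V E : Set} {G : Multigraph V E} where

  across-Joins : ∀ (χ : V → Bool) {e u w} → Joins G e u w →
                 χ across ends G e ≡ χ u xor χ w
  across-Joins χ (inj₁ eq) = cong (χ across_) eq
  across-Joins χ {u = u} {w} (inj₂ eq) =
    trans (cong (χ across_) eq) (xor-comm (χ w) (χ u))

  Joins-other : ∀ {e u w x y} → Joins G e u w → Joins G e x y → u ≡ x ⊎ u ≡ y
  Joins-other (inj₁ p) (inj₁ q) with refl ← trans (sym p) q = inj₁ refl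
  Joins-other (inj₁ p) (inj₂ q) with refl ← trans (sym p) q = inj₂ refl
  Joins-other (inj₂ p) (inj₁ q) with refl ← trans (sym p) q = inj₂ refl
  Joins-other (inj₂ p) (inj₂ q) with refl ← trans (sym p) q = inj₁ refl

  parity : (E → Bool) → ∀ {u w} → Walk G u w → Bool
  parity g stop         = false
  parity g (step e _ p) = g e xor parity g p

  parity-++ : ∀ g {u w x} (p : Walk G u w) (q : Walk G w x) →
              parity g (_++ʷ_ G p q) ≡ parity g p xor parity g q
  parity-++ g stop         q = refl
  parity-++ g (step e _ p) q =
    trans (cong (g e xor_) (parity-++ g p q)) (sym (xor-assoc (g e) _ _))

  parity-reverse : ∀ g {u w} (p : Walk G u w) →
                   parity g (reverse G p) ≡ parity g p
  parity-reverse g stop         = refl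
  parity-reverse g (step e j p) = begin
    parity g (_++ʷ_ G (reverse G p) (step e (⊎-swap j) stop))
      ≡⟨ parity-++ g (reverse G p) _ ⟩
    parity g (reverse G p) xor (g e xor false)
      ≡⟨ cong₂ _xor_ (parity-reverse g p) (xor-identityʳ (g e)) ⟩
    parity g p xor g e
      ≡⟨ xor-comm (parity g p) (g e) ⟩
    g e xor parity g p ∎
    where open ≡-Reasoning

  -- The sum of the coboundary along a walk telescopes.
  parity-across : ∀ (χ : V → Bool) {u w} (p : Walk G u w) →
                  parity (λ e → χ across ends G e) p ≡ χ u xor χ w
  parity-across χ {u} stop = sym (xor-same (χ u))
  parity-across χ {u} {w} (step {w = x} e j p) =
    trans (cong₂ _xor_ (across-Joins χ j) (parity-across χ p))
          (xor-telescope (χ u) (χ x) (χ w))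

  parity-cong : ∀ {g h} → (∀ e → g e ≡ h e) → ∀ {u w} (p : Walk G u w) →
                parity g p ≡ parity h p
  parity-cong g≗h stop         = refl
  parity-cong g≗h (step e _ p) = cong₂ _xor_ (g≗h e) (parity-cong g≗h p)

  edge∈⇒end∈ : ∀ {e u w x y} → Joins G e u w → (p : Walk G x y) →
               e ∈ˡ edges G p → u ∈ˡ x ∷ˡ visited G p
  edge∈⇒end∈ j (step f k p) (here refl) with Joins-other j k
  ... | inj₁ u≡x = here u≡x
  ... | inj₂ u≡z = there (here u≡z)
  edge∈⇒end∈ j (step f k p) (there e∈p) = there (edge∈⇒end∈ j p e∈p)

  -- If the first edge occurred again, the initial vertex would be visited a second time.
  IsPath⇒Unique-edges : ∀ {u w} (p : Walk G u w) → IsPath G p → Unique (edges G p)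
  IsPath⇒Unique-edges stop         _            = []ᵘ
  IsPath⇒Unique-edges (step e j p) (u∉ ∷ᵘ path) =
    ¬Any⇒All¬ _ (All¬⇒¬Any u∉ ∘ edge∈⇒end∈ j p) ∷ᵘ IsPath⇒Unique-edges p path

  end∈visited : ∀ {u w x} e (j : Joins G e u w) (p : Walk G w x) →
                x ∈ˡ visited G (step e j p)
  end∈visited e j stop         = here refl
  end∈visited e j (step f k p) = there (end∈visited f k p)

  -- A path from `u` to `u` is empty: otherwise its last vertex repeats its first.
  parity-closed-path : ∀ g {u} (p : Walk G u u) → IsPath G p → parity g p ≡ false
  parity-closed-path g stop         _         = refl
  parity-closed-path g (step e j p) (u∉ ∷ᵘ _) =
    contradiction (end∈visited e j p) (All¬⇒¬Any u∉)

  -- The inclusion of the visited vertices is what keeps the initial part a path when the induction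
  -- prepends an edge.
  splitPath : ∀ {u w x} (p : Walk G u w) → IsPath G p → x ∈ˡ u ∷ˡ visited G p →
    Σ (Path G u x) λ (q , _) → Σ (Path G x w) λ (r , _) →
      visited G q ⊆ visited G p × (∀ g → parity g p ≡ parity g q xor parity g r)
  splitPath p path (here refl) =
    (stop , []ᵃ ∷ᵘ []ᵘ) , (p , path) , (λ ()) , λ _ → refl
  splitPath (step e j p) (u∉ ∷ᵘ path) (there x∈)
    with (q , q-path) , r , q⊆p , eq ← splitPath p path x∈ =
    (step e j q , All-resp-⊇ (∷⁺ʳ _ q⊆p) u∉ ∷ᵘ q-path) , r , ∷⁺ʳ _ q⊆p ,
    λ g → trans (cong (g e xor_) (eq g)) (sym (xor-assoc (g e) _ _))

  module _ (_≟_ : DecidableEquality E) where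

    -- No edge repeats, so an edge is counted once or not at all.
    parity-member : ∀ {u w} (p : Walk G u w) → Unique (edges G p) → ∀ e →
                    parity (λ f → does (e ≟ f)) p ≡ does (member? _≟_ e (edges G p))
    parity-member stop         _             e = refl
    parity-member (step f _ p) (f∉ ∷ᵘ unique) e with e ≟ f | parity-member p unique e
    ... | no _     | ih = ih
    ... | yes refl | ih =
      cong not (trans ih (dec-false (member? _≟_ e (edges G p)) (All¬⇒¬Any f∉)))

-- Closed walks in acyclic graphs

module _ {V E : Set} (_≟ⱽ_ : DecidableEquality V) (_≟ᴱ_ : DecidableEquality E)
         {G : Multigraph V E} (acyclic : Acyclic G) where

  -- If p avoided e, then e would close it to a cycle.
  parity-detour : ∀ g {e u w} → Joins G e u w → (p : Walk G w u) → IsPath G p →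
                  parity g p ≡ g e
  parity-detour g {e} j p path with member? _≟ᴱ_ e (edges G p)
  parity-detour g j p path | no e∉p =
    ⊥-elim (acyclic _ (step _ j p)
      ((λ ()) , ¬Any⇒All¬ _ e∉p ∷ᵘ IsPath⇒Unique-edges p path , path))
  -- As `e` has the end `w`, which the path never revisits, `e` can only be the first edge. The path
  -- is then back at `u` at once, and its rest is a closed path.
  parity-detour g j (step f k p) (w∉ ∷ᵘ _) | yes (there e∈p) =
    contradiction (edge∈⇒end∈ (⊎-swap j) p e∈p) (All¬⇒¬Any w∉)
  parity-detour g j (step f k p) (w∉ ∷ᵘ path) | yes (here refl)
    with Joins-other {G = G} (⊎-swap k) (⊎-swap j)
  ... | inj₁ refl = contradiction (here refl) (All¬⇒¬Any w∉)
  ... | inj₂ refl =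
    trans (cong (g f xor_) (parity-closed-path g p path)) (xor-identityʳ (g f))

  -- If the path `q` already meets `u`, the round trip along `e` and back along the part `d` of `q`
  -- can be cut out: by `parity-detour` both halves contribute `g e`, so they cancel.
  eraseLoops : ∀ {u w} (p : Walk G u w) →
    Σ (Path G u w) λ (q , _) → ∀ g → parity g p ≡ parity g q
  eraseLoops stop = (stop , []ᵃ ∷ᵘ []ᵘ) , λ _ → refl
  eraseLoops {u} (step {w = x} e j p)
    with (q , path) , eq ← eraseLoops p
    with member? _≟ⱽ_ u (x ∷ˡ visited G q)
  ... | no u∉ = (step e j q , ¬Any⇒All¬ _ u∉ ∷ᵘ path) , λ g → cong (g e xor_) (eq g)
  ... | yes u∈ with (d , d-path) , r , _ , q≡dr ← splitPath q path u∈ =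
    r , λ g → begin
      g e xor parity g p
        ≡⟨ cong (g e xor_) (trans (eq g) (q≡dr g)) ⟩
      g e xor (parity g d xor parity g (proj₁ r))
        ≡⟨ cong (λ a → g e xor (a xor _)) (parity-detour g j d d-path) ⟩
      g e xor (g e xor parity g (proj₁ r))
        ≡⟨ xor-cancelˡ (g e) _ ⟩
      parity g (proj₁ r) ∎
    where open ≡-Reasoning

  parity-closed : ∀ g {u} (p : Walk G u u) → parity g p ≡ false
  parity-closed g p with (q , path) , eq ← eraseLoops p =
    trans (eq g) (parity-closed-path g q path)

-- Fundamental cuts

record IsCuts {V E : Set} (G : Multigraph V E) (χ : E → V → Bool) : Set where
  field
    own   : ∀ e → χ e across ends G e ≡ true
    other : ∀ {e f} → e ≢ f → χ e across ends G f ≡ false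

open IsCuts

module _ {V E : Set} (_≟ⱽ_ : DecidableEquality V) (_≟ᴱ_ : DecidableEquality E)
         {G : Multigraph V E} where

  fundamentalCuts : Connected G → E → V → Bool
  fundamentalCuts (r , path) e u = parity (λ f → does (e ≟ᴱ f)) (proj₁ (path r u))

  -- The closed walk from the root to one end of `f`, over `f` and back to the root has even parity.
  -- Its three pieces contribute the sides of the two ends and `δ f`.
  fundamentalCuts-across : ∀ (tree : IsTree G) e f →
    fundamentalCuts (proj₁ tree) e across ends G f ≡ does (e ≟ᴱ f)
  fundamentalCuts-across ((r , path) , acyclic) e f = xor-≡ (begin
    (parity δ p xor parity δ q) xor δ f
      ≡⟨ xor-assoc (parity δ p) (parity δ q) (δ f) ⟩
    parity δ p xor (parity δ q xor δ f)
      ≡⟨ cong (parity δ p xor_) (xor-comm (parity δ q) (δ f)) ⟩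
    parity δ p xor (δ f xor parity δ q)
      ≡⟨ cong (λ a → parity δ p xor (δ f xor a)) (parity-reverse δ q) ⟨
    parity δ p xor (δ f xor parity δ (reverse G q))
      ≡⟨ parity-++ δ p _ ⟨
    parity δ closed
      ≡⟨ parity-closed _≟ⱽ_ _≟ᴱ_ acyclic δ closed ⟩
    false ∎)
    where
    open ≡-Reasoning
    δ : E → Bool
    δ f = does (e ≟ᴱ f)

    p = proj₁ (path r (proj₁ (ends G f)))
    q = proj₁ (path r (proj₂ (ends G f)))

    closed : Walk G r r
    closed = _++ʷ_ G p (step f (inj₁ refl) (reverse G q))

  fundamentalCuts-isCuts : (tree : IsTree G) → IsCuts G (fundamentalCuts (proj₁ tree))
  fundamentalCuts-isCuts tree .own e =
    trans (fundamentalCuts-across tree e e) (dec-true (e ≟ᴱ e) refl)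
  fundamentalCuts-isCuts tree .other {e} {f} e≢f =
    trans (fundamentalCuts-across tree e f) (dec-false (e ≟ᴱ f) e≢f)

module _ {V E : Set} {G : Multigraph V E} {χ : E → V → Bool} (cuts : IsCuts G χ) where

  across-avoids : ∀ e {u w} (p : Walk G u w) → e ∉ˡ edges G p → χ e u ≡ χ e w
  across-avoids e stop         _  = refl
  across-avoids e (step f j p) e∉ = trans
    (xor-≡ (trans (sym (across-Joins {G = G} (χ e) j)) (cuts .other (e∉ ∘ here))))
    (across-avoids e p (e∉ ∘ there))

  -- The rest of a cycle avoids its first edge `e` and so stays on one side of `χ e`, yet it
  -- connects the two ends of `e`, which `χ e` separates.
  cuts⇒acyclic : Acyclic G
  cuts⇒acyclic u stop         (nonempty , _)    = nonempty refl
  cuts⇒acyclic u (step e j p) (_ , e∉ ∷ᵘ _ , _) =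
    xor-≢ (trans (sym (across-Joins {G = G} (χ e) j)) (cuts .own e))
      (sym (across-avoids e p (All¬⇒¬Any e∉)))

  -- The indicator of `e` is the coboundary of `χ e`. Along a path the indicator sums to membership,
  -- the coboundary to the difference of the sides of the ends.
  path-crosses-cut : (_≟_ : DecidableEquality E) → ∀ e {u w} ((p , _) : Path G u w) →
    does (member? _≟_ e (edges G p)) ≡ χ e u xor χ e w
  path-crosses-cut _≟_ e {u} {w} (p , path) = begin
    does (member? _≟_ e (edges G p))
      ≡⟨ parity-member _≟_ p (IsPath⇒Unique-edges p path) e ⟨
    parity (λ f → does (e ≟ f)) p
      ≡⟨ parity-cong δ≗across p ⟩
    parity (λ f → χ e across ends G f) p
      ≡⟨ parity-across (χ e) p ⟩
    χ e u xor χ e w ∎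
    where
    open ≡-Reasoning
    δ≗across : ∀ f → does (e ≟ f) ≡ χ e across ends G f
    δ≗across f with e ≟ f
    ... | yes refl = sym (cuts .own e)
    ... | no e≢f   = sym (cuts .other e≢f)

-- Transport of walks and indices

-- Edges go to walks because a contracted edge becomes an empty walk and a lifted edge may need
-- detours at its ends.
mapWalk : ∀ {V V′ E E′} {G : Multigraph V E} {G′ : Multigraph V′ E′} (φ : V → V′) →
          (∀ {e u w} → Joins G e u w → Walk G′ (φ u) (φ w)) →
          ∀ {u w} → Walk G u w → Walk G′ (φ u) (φ w)
mapWalk φ h stop         = stop
mapWalk {G′ = G′} φ h (step e j p) = _++ʷ_ G′ (h j) (mapWalk φ h p)

to-injective : ∀ {A B : Set} (A↔B : A ↔ B) {x y} → to A↔B x ≡ to A↔B y → x ≡ y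
to-injective = Injection.injective ∘ ↔⇒↣

from-injective : ∀ {A B : Set} (A↔B : A ↔ B) {x y} → from A↔B x ≡ from A↔B y → x ≡ y
from-injective = to-injective ∘ ↔-sym

module _ {q} {T : Subset q} where

  ∃∈-≡ : {x y : ∃ (_∈ T)} → proj₁ x ≡ proj₁ y → x ≡ y
  ∃∈-≡ {_ , p} {_ , p′} refl = cong (_ ,_) ([]=-irrelevant p p′)

  _≟ₑ_ : DecidableEquality (∃ (_∈ T))
  (x , p) ≟ₑ (y , p′) = map′ ∃∈-≡ (cong proj₁) (x ≟ y)

-- Representation matrices in terms of cuts

module _ {p q} (G : FinMultigraph p q) (T : Subset q) where

  -- Any family of cuts will do, not just the one computed from a root, so this serves both for
  -- reading off cuts and for building a representation from them.
  M-across : (tree : IsSpanningTree G T) → ∀ {χ} → IsCuts (spanned G T) χ → ∀ e f →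
             M[_,_] G T tree e f ≡ χ e across ends G (proj₁ f)
  M-across tree cuts (e , e∈T) (f , _) = trans
    -- `fundamentalEdges` forgets that its edges lie in `T`; restoring the proofs turns the entry
    -- into a membership test in the tree itself.
    (does-⇔ (mk⇔ ∈-map-proj₁⁻ (∈-map⁺ proj₁))
      (member? _≟_ e (fundamentalEdges G T tree f)) (member? _≟ₑ_ (e , e∈T) _))
    (path-crosses-cut cuts _≟ₑ_ (e , e∈T) (fundamentalPath G T tree f))
    where
    ∈-map-proj₁⁻ : ∀ {es} → e ∈ˡ mapˡ proj₁ es → (e , e∈T) ∈ˡ es
    ∈-map-proj₁⁻ e∈ with _ , y∈ , eq ← ∈-map⁻ proj₁ e∈ =
      subst (_∈ˡ _) (sym (∃∈-≡ eq)) y∈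

  unspan : ∀ {u w} → Walk (spanned G T) u w → Walk G u w
  unspan stop               = stop
  unspan (step (e , _) j p) = step e j (unspan p)

  visited-unspan : ∀ {u w} (p : Walk (spanned G T) u w) →
                   visited G (unspan p) ≡ visited (spanned G T) p
  visited-unspan stop         = refl
  visited-unspan (step _ _ p) = cong (_ ∷ˡ_) (visited-unspan p)

  spanned-connected : Connected (spanned G T) → Connected G
  spanned-connected (r , path) = r , λ u w →
    let (p , isPath) = path u w in
    unspan p , subst (Unique ∘ (u ∷ˡ_)) (sym (visited-unspan p)) isPath

-- Rows and columns themselves serve as tree edges and chords, over arbitrary index types, so that a
-- row can be split off as `I ⊎ Fin 1`. Walks suffice for connectedness, and `cuts` implies
-- acyclicity.
record CutRepresentation {I J : Set} (p : ℕ) (M : I → J → Bool) : Set where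
  field
    root       : Fin p
    tree       : Multigraph (Fin p) I
    walk       : ∀ u w → Walk tree u w
    chord      : J → Fin p × Fin p
    cut        : I → Fin p → Bool
    cuts       : IsCuts tree cut
    represents : ∀ i j → M i j ≡ cut i across chord j

reindex : ∀ {I K J p} {M : I → J → Bool} {N : K → J → Bool} (f : K ↔ I) →
          (∀ k j → N k j ≡ M (to f k) j) → CutRepresentation p M → CutRepresentation p N
reindex f N≗M C = record
  { root       = C.root
  ; tree       = record { ends = ends C.tree ∘ to f }
  ; walk       = λ u w → mapWalk id
      (λ j → step (from f _)
        (subst (λ i → Joins C.tree i _ _) (sym (strictlyInverseˡ f _)) j) stop)
      (C.walk u w)
  ; chord      = C.chord
  ; cut        = C.cut ∘ to f
  ; cuts       = record { own   = C.cuts .own ∘ to f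
                        ; other = λ k≢l → C.cuts .other (k≢l ∘ to-injective f) }
  ; represents = λ k j → trans (N≗M k j) (C.represents (to f k) j)
  }
  where module C = CutRepresentation C

-- The value of side at v itself is irrelevant.
record Splitting {I J p} {M : I → J → Bool}
                 (C : CutRepresentation p M) (b : J → Bool) : Set where
  open CutRepresentation C
  field
    v          : Fin p
    side       : Fin p → Bool
    tree-side  : ∀ i → proj₁ (ends tree i) ≢ v → proj₂ (ends tree i) ≢ v →
                 side across ends tree i ≡ false
    chord-side : ∀ j → proj₁ (chord j) ≢ v → proj₂ (chord j) ≢ v →
                 side across chord j ≡ b j

-- Contracting a tree edge

module _ {I J p} {M : I ⊎ Fin 1 → J → Bool} (C : CutRepresentation (suc p) M) where

  open CutRepresentation C

  private
    e₀ : I ⊎ Fin 1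
    e₀ = inj₂ zero

    a c : Fin (suc p)
    a = proj₁ (ends tree e₀)
    c = proj₂ (ends tree e₀)

    c≢a : c ≢ a
    c≢a c≡a = xor-≢ (cuts .own e₀) (sym (cong (cut e₀) c≡a))

    ι : Fin p → Fin (suc p)
    ι = punchIn c

    -- The contraction, merging `c` into `a`. Its section `ι` represents the merged vertex by `a`.
    π : Fin (suc p) → Fin p
    π x with c ≟ x
    ... | yes _  = punchOut c≢a
    ... | no c≢x = punchOut c≢x

    ι-π : ∀ x → ι (π x) ≡ x ⊎ (x ≡ c × ι (π x) ≡ a)
    ι-π x with c ≟ x
    ... | yes c≡x = inj₂ (sym c≡x , punchIn-punchOut c≢a)
    ... | no c≢x  = inj₁ (punchIn-punchOut c≢x)

    π-ι : ∀ y → π (ι y) ≡ y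
    π-ι y with ι-π (ι y)
    ... | inj₁ eq       = punchIn-injective c _ _ eq
    ... | inj₂ (eq , _) = contradiction eq (punchInᵢ≢i c y)

    ι-π-a : ι (π a) ≡ a
    ι-π-a with ι-π a
    ... | inj₁ eq       = eq
    ... | inj₂ (eq , _) = contradiction (sym eq) c≢a

    π-c : π c ≡ π a
    π-c with ι-π c
    ... | inj₁ eq       = contradiction eq (punchInᵢ≢i c _)
    ... | inj₂ (_ , eq) = punchIn-injective c _ _ (trans eq (sym ι-π-a))

    ι-π-≢ : ∀ x → π x ≢ π a → ι (π x) ≡ x
    ι-π-≢ x πx≢πa with ι-π x
    ... | inj₁ eq         = eq
    ... | inj₂ (refl , _) = contradiction π-c πx≢πa

    -- The cuts of the other tree edges do not separate `a` from `c`, so they descend to the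
    -- contracted tree.
    cut-ι-π : ∀ i x → cut (inj₁ i) (ι (π x)) ≡ cut (inj₁ i) x
    cut-ι-π i x with ι-π x
    ... | inj₁ eq          = cong (cut (inj₁ i)) eq
    ... | inj₂ (refl , eq) = trans (cong (cut (inj₁ i)) eq) (xor-≡ (cuts .other λ ()))

    cut-across : ∀ i uw → (cut (inj₁ i) ∘ ι) across ×-map π π uw ≡ cut (inj₁ i) across uw
    cut-across i (u , w) = cong₂ _xor_ (cut-ι-π i u) (cut-ι-π i w)

    -- The cut of `e₀` separates `a` from `c` and cannot descend to the merged vertex, but elsewhere
    -- `ι` undoes `π`.
    side-across : ∀ uw → let (u , w) = ×-map π π uw in u ≢ π a → w ≢ π a →
                  (cut e₀ ∘ ι) across (u , w) ≡ cut e₀ across uw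
    side-across (u , w) u≢ w≢ =
      cong₂ _xor_ (cong (cut e₀) (ι-π-≢ u u≢)) (cong (cut e₀) (ι-π-≢ w w≢))

    contracted : Multigraph (Fin p) I
    contracted .ends = ×-map π π ∘ ends tree ∘ inj₁

    contract-step : ∀ {e u w} → Joins tree e u w → Walk contracted (π u) (π w)
    contract-step {inj₁ i} j = step i (⊎-map (cong (×-map π π)) (cong (×-map π π)) j) stop
    -- The contracted edge becomes the empty walk at the merged vertex.
    contract-step {inj₂ zero} (inj₁ refl) = subst (Walk contracted (π a)) (sym π-c) stop
    contract-step {inj₂ zero} (inj₂ refl) = subst (λ u → Walk contracted u (π a)) (sym π-c) stop

  contract : CutRepresentation p (M ∘ inj₁)
  contract = record
    { root       = π root
    ; tree       = contracted
    ; walk       = λ u w → subst₂ (Walk contracted) (π-ι u) (π-ι w)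
                             (mapWalk π contract-step (walk (ι u) (ι w)))
    ; chord      = ×-map π π ∘ chord
    ; cut        = λ i → cut (inj₁ i) ∘ ι
    ; cuts       = record
      { own   = λ i → trans (cut-across i _) (cuts .own (inj₁ i))
      ; other = λ i≢j → trans (cut-across _ _) (cuts .other (i≢j ∘ inj₁-injective)) }
    ; represents = λ i j → trans (represents (inj₁ i) j) (sym (cut-across i (chord j)))
    }

  contract-splitting : Splitting contract (M (inj₂ zero))
  contract-splitting = record
    { v          = π a
    ; side       = cut e₀ ∘ ι
    ; tree-side  = λ i u≢ w≢ → trans (side-across _ u≢ w≢) (cuts .other λ ())
    ; chord-side = λ j u≢ w≢ → trans (side-across (chord j) u≢ w≢) (sym (represents e₀ j))
    }

-- Splitting a vertex

module _ {I J p} {M : I → J → Bool} (C : CutRepresentation p M) {b : J → Bool}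
         (S : Splitting C b) where

  open CutRepresentation C
  open Splitting S

  private
    -- The vertex `v` is split into `zero` and `suc v`, and `π` merges these copies again.
    π : Fin (suc p) → Fin p
    π zero    = v
    π (suc x) = x

    -- The old copy of v keeps its arbitrary side and the new copy gets the other one.
    σ : Fin (suc p) → Bool
    σ zero    = not (side v)
    σ (suc x) = side x

    -- The copies of `v` lie on opposite sides of `σ`, so each side `s` contains exactly one of
    -- them.
    copy : Bool → Fin (suc p)
    copy s = if s xor side v then zero else suc v

    π-copy : ∀ s → π (copy s) ≡ v
    π-copy s with s xor side v
    ... | true  = refl
    ... | false = refl

    σ-copy : ∀ s → σ (copy s) ≡ s
    σ-copy s with side v in eq | s
    ... | true  | true  = eq
    ... | true  | false = cong not eq
    ... | false | true  = cong not eq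
    ... | false | false = eq

    Lift : Fin p × Fin p → Bool → Set
    Lift uw s = ∃ λ xy → ×-map π π xy ≡ uw × σ across xy ≡ s

    -- An end at `v` can be put on whichever side makes the total equal to `s`; only a pair avoiding
    -- `v` leaves no choice.
    lift : ∀ uw s → (proj₁ uw ≢ v → proj₂ uw ≢ v → side across uw ≡ s) → Lift uw s
    lift (u , w) s coherent with u ≟ v | w ≟ v
    ... | no u≢v   | no w≢v = (suc u , suc w) , refl , coherent u≢v w≢v
    -- For a loop at `v`, the second end stays at the old copy and only the first is chosen.
    ... | yes refl | _      =
      (copy (s xor side w) , suc w) , cong (_, w) (π-copy (s xor side w)) ,
      trans (cong (_xor side w) (σ-copy (s xor side w)))
        (trans (xor-assoc s (side w) (side w))
          (trans (cong (s xor_) (xor-same (side w))) (xor-identityʳ s)))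
    ... | no _     | yes refl =
      (suc u , copy (side u xor s)) , cong (u ,_) (π-copy (side u xor s)) ,
      trans (cong (side u xor_) (σ-copy (side u xor s))) (xor-cancelˡ (side u) s)

    -- Old tree edges must not cross the new cut `σ`, whereas chord `j` has to cross it as the new
    -- entry `b j` prescribes.
    liftTree : ∀ i → Lift (ends tree i) false
    liftTree i = lift (ends tree i) false (tree-side i)

    liftChord : ∀ j → Lift (chord j) (b j)
    liftChord j = lift (chord j) (b j) (chord-side j)

    extended : Multigraph (Fin (suc p)) (I ⊎ Fin 1)
    extended .ends (inj₁ i) = proj₁ (liftTree i)
    extended .ends (inj₂ _) = zero , suc v

    cut′ : I ⊎ Fin 1 → Fin (suc p) → Bool
    cut′ (inj₁ i) = cut i ∘ π
    cut′ (inj₂ _) = σ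

    lift-across : ∀ (χ : Fin p → Bool) {uw s} ((xy , _) : Lift uw s) →
                  (χ ∘ π) across xy ≡ χ across uw
    lift-across χ (_ , eq , _) = cong (χ across_) eq

    cuts′ : IsCuts extended cut′
    cuts′ .own (inj₁ i)    = trans (lift-across (cut i) (liftTree i)) (cuts .own i)
    cuts′ .own (inj₂ zero) = ≢-xor (not-¬ {x = side v} refl ∘ sym)
    cuts′ .other {inj₁ i} {inj₁ k} i≢k =
      trans (lift-across (cut i) (liftTree k)) (cuts .other (i≢k ∘ cong inj₁))
    -- Both ends of the new edge lie over `v`, so no old cut separates them.
    cuts′ .other {inj₁ i} {inj₂ zero} _ = xor-same (cut i v)
    cuts′ .other {inj₂ zero} {inj₁ k} _ = proj₂ (proj₂ (liftTree k))
    cuts′ .other {inj₂ zero} {inj₂ zero} e≢f = contradiction refl e≢f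

    -- Distinct vertices in one fibre of `π` are the two copies of `v`, which the new edge joins.
    fibreWalk : ∀ x y → π x ≡ π y → Walk extended x y
    fibreWalk zero    zero    _    = stop
    fibreWalk zero    (suc y) refl = step (inj₂ zero) (inj₁ refl) stop
    fibreWalk (suc x) zero    refl = step (inj₂ zero) (inj₂ refl) stop
    fibreWalk (suc x) (suc y) refl = stop

    _⟫_ : ∀ {u w x} → Walk extended u w → Walk extended w x → Walk extended u x
    _⟫_ = _++ʷ_ extended

    -- A lifted edge may be attached to the new copy of `v`, so walks inside the fibres link it to
    -- the old copies.
    lift-step : ∀ {i u w} → Joins tree i u w → Walk extended (suc u) (suc w)
    lift-step {i} (inj₁ eq) =
      fibreWalk (suc _) _ (sym (cong proj₁ π-ends)) ⟫
      (step (inj₁ i) (inj₁ refl) stop ⟫ fibreWalk _ (suc _) (cong proj₂ π-ends))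
      where π-ends = trans (proj₁ (proj₂ (liftTree i))) eq
    lift-step {i} (inj₂ eq) =
      fibreWalk (suc _) _ (sym (cong proj₂ π-ends)) ⟫
      (step (inj₁ i) (inj₂ refl) stop ⟫ fibreWalk _ (suc _) (cong proj₁ π-ends))
      where π-ends = trans (proj₁ (proj₂ (liftTree i))) eq

  extend : CutRepresentation (suc p) [ M , b ∷ [] ]′
  extend = record
    { root       = zero
    ; tree       = extended
    ; walk       = λ x y → fibreWalk x (suc (π x)) refl ⟫
        (mapWalk suc lift-step (walk (π x) (π y)) ⟫ fibreWalk (suc (π y)) y refl)
    ; chord      = proj₁ ∘ liftChord
    ; cut        = cut′
    ; cuts       = cuts′
    ; represents = λ where
        (inj₁ i)    j → trans (represents i j) (sym (lift-across (cut i) (liftChord j)))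
        (inj₂ zero) j → sym (proj₂ (proj₂ (liftChord j)))
    }

-- From graphs to trees with cuts

module _ {m n} {M : BinaryMatrix m n} (R : Representation M) where

  open Representation R

  private
    treeCuts : IsCuts (spanned graph T) _
    treeCuts = fundamentalCuts-isCuts _≟_ _≟ₑ_ spanningTree

  toCuts : CutRepresentation order M
  toCuts = record
    { root       = proj₁ connected
    ; tree       = record { ends = ends graph ∘ proj₁ ∘ to rows }
    ; walk       = λ u w → mapWalk id
        (λ {e} j → step (from rows e)
          (subst (λ e → Joins (spanned graph T) e _ _) (sym (strictlyInverseˡ rows e)) j) stop)
        (proj₁ (proj₂ (proj₁ spanningTree) u w))
    ; chord      = ends graph ∘ proj₁ ∘ to columns
    ; cut        = fundamentalCuts _≟_ _≟ₑ_ (proj₁ spanningTree) ∘ to rows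
    ; cuts       = record
      { own   = treeCuts .own ∘ to rows
      ; other = λ i≢k → treeCuts .other (i≢k ∘ to-injective rows) }
    ; represents = λ i j → trans (represents i j)
        (M-across graph T spanningTree treeCuts (to rows i) (to columns j))
    }

  toSplitting : ∀ {b} → ∃ (Splittable graph (supp b)) → Splitting toCuts b
  toSplitting {b} (v , f , bipartite) = record
    { v          = v
    ; side       = side
    ; tree-side  = λ i u≢v w≢v → trans (side-across u≢v w≢v)
        (≡-xor (kept (to rows i .proj₁) (row∉supp i) u≢v w≢v))
    ; chord-side = chord-side
    }
    where
    side : Fin order → Bool
    side x with x ≟ v
    -- A dummy value: `f` is defined only away from `v`.
    ... | yes _  = false
    ... | no x≢v = Func.to f (x , x≢v)

    side-≢ : ∀ {x} (x≢v : x ≢ v) → side x ≡ Func.to f (x , x≢v)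
    side-≢ {x} x≢v with x ≟ v
    ... | yes x≡v = contradiction x≡v x≢v
    ... | no _    = refl

    side-across : ∀ {u w} (u≢v : u ≢ v) (w≢v : w ≢ v) →
                  side across (u , w) ≡ Func.to f (u , u≢v) xor Func.to f (w , w≢v)
    side-across u≢v w≢v = cong₂ _xor_ (side-≢ u≢v) (side-≢ w≢v)

    ≡-xor : ∀ {s t} → s ≡ t → s xor t ≡ false
    ≡-xor {s} refl = xor-same s

    -- Such an edge survives the deletion, so its ends lie in one component, on which `f` is
    -- constant.
    kept : ∀ e → ¬ supp b e →
           (u≢v : proj₁ (ends graph e) ≢ v) (w≢v : proj₂ (ends graph e) ≢ v) →
           Func.to f (_ , u≢v) ≡ Func.to f (_ , w≢v)
    kept e e∉Y u≢v w≢v = Func.cong f (step (e , e∉Y , u≢v , w≢v) (inj₁ refl) stop)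

    row∉supp : ∀ i → ¬ supp b (to rows i .proj₁)
    row∉supp i (j , _ , eq) =
      x∈p⇒x∉∁p (proj₂ (to rows i)) (subst (_∈ ∁ T) eq (proj₂ (to columns j)))

    -- Since `columns` is injective, no other column can put this edge into the support.
    column∉supp : ∀ j → b j ≡ false → ¬ supp b (to columns j .proj₁)
    column∉supp j bj≡false (k , bk≡true , eq)
      with refl ← to-injective columns (∃∈-≡ {x = to columns k} {to columns j} eq)
      with () ← trans (sym bk≡true) bj≡false

    chord-side : ∀ j → let (u , w) = ends graph (to columns j .proj₁) in
                 u ≢ v → w ≢ v → side across (u , w) ≡ b j
    chord-side j u≢v w≢v with b j in bj
    -- The chord lies in the support and makes the components of its ends adjacent in the auxiliary
    -- graph.
    ... | true  = trans (side-across u≢v w≢v) (≢-xor (bipartite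
      ( to columns j .proj₁ , (j , bj , refl)
      , (_ , u≢v) , (_ , w≢v) , inj₁ refl , stop , stop )))
    ... | false = trans (side-across u≢v w≢v)
      (≡-xor (kept (to columns j .proj₁) (column∉supp j bj) u≢v w≢v))

-- From trees with cuts to graphs

module _ {m n p} {M : BinaryMatrix m n} (C : CutRepresentation p M) where

  open CutRepresentation C

  private
    G : FinMultigraph p (m + n)
    G .ends e = [ ends tree , chord ]′ (splitAt m e)

    T : Subset (m + n)
    T = tabulate λ e → [ const true , const false ]′ (splitAt m e)

    ends-↑ˡ : ∀ i → ends G (i ↑ˡ n) ≡ ends tree i
    ends-↑ˡ i = cong [ ends tree , chord ]′ (splitAt-↑ˡ m i n)

    ends-↑ʳ : ∀ j → ends G (m ↑ʳ j) ≡ chord j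
    ends-↑ʳ j = cong [ ends tree , chord ]′ (splitAt-↑ʳ m n j)

    ↑ˡ∈T : ∀ i → i ↑ˡ n ∈ T
    ↑ˡ∈T i = lookup⇒[]= _ T
      (trans (lookup∘tabulate _ (i ↑ˡ n)) (cong [ _ , _ ]′ (splitAt-↑ˡ m i n)))

    ↑ʳ∉T : ∀ j → m ↑ʳ j ∉ T
    ↑ʳ∉T j ∈T with () ← trans (sym ([]=⇒lookup ∈T))
      (trans (lookup∘tabulate _ (m ↑ʳ j)) (cong [ _ , _ ]′ (splitAt-↑ʳ m n j)))

    -- A view of the edges: matching on it refines the edge itself, as matching on `splitAt` would
    -- not.
    data Split : Fin (m + n) → Set where
      row    : ∀ i → Split (i ↑ˡ n)
      column : ∀ j → Split (m ↑ʳ j)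

    split : ∀ e → Split e
    split e = subst Split (join-splitAt m n e) (split-join (splitAt m e))
      where
      split-join : ∀ x → Split (join m n x)
      split-join (inj₁ i) = row i
      split-join (inj₂ j) = column j

    ∈T⇒row : ∀ {e} → e ∈ T → ∃ λ i → i ↑ˡ n ≡ e
    ∈T⇒row {e} e∈T with split e
    ... | row i    = i , refl
    ... | column j = contradiction e∈T (↑ʳ∉T j)

    ∈∁T⇒column : ∀ {e} → e ∈ ∁ T → ∃ λ j → m ↑ʳ j ≡ e
    ∈∁T⇒column {e} e∈∁T with split e
    ... | row i    = contradiction (↑ˡ∈T i) (x∈∁p⇒x∉p e∈∁T)
    ... | column j = j , refl

    rows : Fin m ↔ ∃ (_∈ T)
    rows = mk↔ₛ′ (λ i → i ↑ˡ n , ↑ˡ∈T i)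
      (λ (e , e∈T) → proj₁ (∈T⇒row e∈T))
      (λ (e , e∈T) → ∃∈-≡ (proj₂ (∈T⇒row e∈T)))
      (λ i → ↑ˡ-injective n _ _ (proj₂ (∈T⇒row (↑ˡ∈T i))))

    columns : Fin n ↔ ∃ (_∈ ∁ T)
    columns = mk↔ₛ′ (λ j → m ↑ʳ j , x∉p⇒x∈∁p (↑ʳ∉T j))
      (λ (e , e∈∁T) → proj₁ (∈∁T⇒column e∈∁T))
      (λ (e , e∈∁T) → ∃∈-≡ (proj₂ (∈∁T⇒column e∈∁T)))
      (λ j → ↑ʳ-injective m _ _ (proj₂ (∈∁T⇒column (x∉p⇒x∈∁p (↑ʳ∉T j)))))

    ends-row : ∀ (e : ∃ (_∈ T)) → ends G (proj₁ e) ≡ ends tree (from rows e)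
    ends-row e = trans (cong (ends G ∘ proj₁) (sym (strictlyInverseˡ rows e)))
                       (ends-↑ˡ (from rows e))

    spannedCuts : IsCuts (spanned G T) (cut ∘ from rows)
    spannedCuts .own e = trans (cong (cut (from rows e) across_) (ends-row e)) (cuts .own _)
    spannedCuts .other {e} {f} e≢f = trans (cong (cut (from rows e) across_) (ends-row f))
      (cuts .other (e≢f ∘ from-injective rows))

    -- Acyclicity comes first, from the cuts; it is then used to reduce walks to the paths that
    -- connectedness demands.
    spanningTree : IsSpanningTree G T
    spanningTree =
      (root , λ u w → proj₁ (eraseLoops _≟_ _≟ₑ_ acyclic (spannedWalk u w))) , acyclic
      where
      acyclic : Acyclic (spanned G T)
      acyclic = cuts⇒acyclic spannedCuts

      spannedWalk : ∀ u w → Walk (spanned G T) u w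
      spannedWalk u w = mapWalk id
        (λ {i} j → step (to rows i) (⊎-map (trans (ends-↑ˡ i)) (trans (ends-↑ˡ i)) j) stop)
        (walk u w)

  fromCuts : Representation M
  fromCuts = record
    { graph        = G
    ; connected    = spanned-connected G T (proj₁ spanningTree)
    ; T            = T
    ; spanningTree = spanningTree
    ; rows         = rows
    ; columns      = columns
    ; represents   = λ i j → begin
        M i j
          ≡⟨ represents i j ⟩
        cut i across chord j
          ≡⟨ cong₂ _across_ (cong cut (strictlyInverseʳ rows i)) (ends-↑ʳ j) ⟨
        cut (from rows (to rows i)) across ends G (m ↑ʳ j)
          ≡⟨ M-across G T spanningTree spannedCuts (to rows i) (to columns j) ⟨
        M[_,_] G T spanningTree (to rows i) (to columns j) ∎
    }
    where open ≡-Reasoning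

  fromSplitting : ∀ {b} → Splitting C b →
    let open Representation fromCuts in ∃ (Splittable graph (supp b))
  fromSplitting {b} S = v , record { to = side ∘ proj₁ ; cong = component-side } , bipartite
    where
    open Splitting S
    open Representation fromCuts using (supp)

    -- The indicator of `supp b` on all edges. It merges the two conditions of `Splitting` into one.
    b̂ : Fin (m + n) → Bool
    b̂ e = [ const false , b ]′ (splitAt m e)

    b̂-∈ : ∀ {e} → supp b e → b̂ e ≡ true
    b̂-∈ (j , bj≡true , refl) = trans (cong [ const false , b ]′ (splitAt-↑ʳ m n j)) bj≡true

    b̂-∉ : ∀ {e} → ¬ supp b e → b̂ e ≡ false
    b̂-∉ {e} e∉Y with split e
    ... | row i    = cong [ const false , b ]′ (splitAt-↑ˡ m i n)
    ... | column j = trans (cong [ const false , b ]′ (splitAt-↑ʳ m n j))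
                           (¬-not λ bj≡true → e∉Y (j , bj≡true , refl))

    edge-side : ∀ e → proj₁ (ends G e) ≢ v → proj₂ (ends G e) ≢ v →
                side across ends G e ≡ b̂ e
    edge-side e with splitAt m e
    ... | inj₁ i = tree-side i
    ... | inj₂ j = chord-side j

    joins-side : ∀ {e u w} → Joins G e u w → u ≢ v → w ≢ v → side u xor side w ≡ b̂ e
    joins-side {e} joins u≢v w≢v =
      trans (sym (across-Joins {G = G} side joins)) (case joins of λ where
        (inj₁ refl) → edge-side e u≢v w≢v
        (inj₂ refl) → edge-side e w≢v u≢v)

    -- Edges left after the deletion lie outside the support and avoid `v`, so `side` is constant
    -- along walks.
    component-side : ∀ {h₁ h₂} → Walk (deleted G (supp b) v) h₁ h₂ →
                     side (proj₁ h₁) ≡ side (proj₁ h₂)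
    component-side stop = refl
    component-side {_ , u≢v} (step {w = _ , w≢v} (e , e∉Y , _) joins q) = trans
      (xor-≡ (trans (joins-side {e} (⊎-map (cong forget) (cong forget) joins) u≢v w≢v)
                    (b̂-∉ e∉Y)))
      (component-side q)
      where
      forget : ∀ {P : Pred (Fin p) 0ℓ} → ∃ P × ∃ P → Fin p × Fin p
      forget = ×-map proj₁ proj₁

    bipartite : ∀ {h₁ h₂} → Graph.Adj (auxiliary G (supp b) v) h₁ h₂ →
                side (proj₁ h₁) ≢ side (proj₁ h₂)
    bipartite (e , e∈Y , (_ , u≢v) , (_ , w≢v) , joins , u∼h₁ , w∼h₂) eq =
      xor-≢ (trans (joins-side {e} joins u≢v w≢v) (b̂-∈ e∈Y))
            (trans (component-side u∼h₁) (trans eq (sym (component-side w∼h₂))))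

-- The equivalence

theorem12 : (m n : ℕ) (M : BinaryMatrix m n) (b : Vector Bool n) →
    Graphic (M ++ (b ∷ [])) ⇔
    Σ (Representation M) λ R → let open Representation R in
    ∃ λ v → Splittable graph (supp b) v
theorem12 m n M b = mk⇔ contracting splitting
  where
  splitting : (Σ (Representation M) λ R → let open Representation R in
               ∃ λ v → Splittable graph (supp b) v) → Graphic (M ++ (b ∷ []))
  splitting (R , splittable) = fromCuts
    (reindex +↔⊎ (λ _ _ → refl) (extend (toCuts R) (toSplitting R splittable)))

  contracting : Graphic (M ++ (b ∷ [])) →
                Σ (Representation M) λ R → let open Representation R in
                ∃ λ v → Splittable graph (supp b) v
  contracting R with Representation.order R | toCuts R
  -- The root rules out order zero, so there is a vertex to lose in the contraction.
  ... | zero  | C with () ← CutRepresentation.root C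
  ... | suc p | C = fromCuts (contract C′) , fromSplitting (contract C′) (contract-splitting C′)
    where
    C′ : CutRepresentation (suc p) [ M , b ∷ [] ]′
    -- The row of `b` becomes the index `inj₂ zero`, the edge that `contract` removes.
    C′ = reindex (↔-sym +↔⊎)
      (λ k j → cong (λ x → [ M , b ∷ [] ]′ x j) (sym (splitAt-join m 1 k))) C
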